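{- Let $p\ge 1$ and $b\ge 1$ be integers, let $K_n$ be the complete graph on $n=b+p^b$ vertices, let $\lambda$ be a $p$-periodic 1-labeling of $K_n$, and let $\mathcal{K}=(K_n,\lambda)$. Then $b\le M_p(\mathcal{K})\le n-1$. Both bounds are tight: there is a $p$-periodic 1-labeling of $K_n$ for which $M_p=b$, and there is one for which $M_p=n-1$.
   Context: A $p$-periodic 1-labeling $\lambda$ of a finite simple undirected graph $G=(V,E)$ assigns to each edge $e$ an infinite set of time-steps of the form $\{i,i+p,i+2p,\dots\}$ with $i\in\{1,\dots,p\}$ (so each edge is present exactly once in every $p$ consecutive time-steps). In the temporal graph $\mathcal{G}=(G,\lambda)$, a journey from $u$ to $v$ is a path in $G$ from $u$ to $v$ together with a choice, for each edge of the path, of a time-step in its label set so that the chosen time-steps are strictly increasing along the path. The temporal distance $\mathrm{dist}_t(u,v)$ is the smallest time-step at which a journey from $u$ reaches $v$ (with $\mathrm{dist}_t(u,u)=0$, and $\infty$ if there is no journey). A set $R\subseteq V$ is a temporal resolving set if (i) for every $v\in V$ there is a journey from some $s\in R$ to $v$ (every vertex is reached from itself), and (ii) for every two distinct $u,v\in V$ there is $s\in R$ with $\mathrm{dist}_t(s,u)\neq\mathrm{dist}_t(s,v)$. $M_p(\mathcal{G})$ denotes the minimum size of a temporal resolving set of $\mathcal{G}$. -}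

module Defs where

open import Data.Fin using (Fin; toℕ; _≟_)
open import Data.Fin.Subset using (Subset; _∈_; ∣_∣)
open import Data.List using (List; []; _∷_)
open import Data.List.Relation.Unary.Unique.Propositional using (Unique)
open import Data.Nat using (ℕ; suc; _+_; _*_; _≤_; _<_)
open import Data.Product using (∃-syntax; Σ-syntax; _×_)
open import Function using (_∘_)
open import Relation.Binary using (Symmetric; Irreflexive; Decidable)
open import Relation.Binary.PropositionalEquality using (_≡_; _≢_; sym)
open import Relation.Nullary using (¬_)
open import Relation.Nullary.Construct.Add.Supremum using (_⁺; ⊤⁺; [_])
open import Relation.Nullary.Decidable using (¬?)

record Graph (n : ℕ) : Set₁ where
  field
    Adj        : Fin n → Fin n → Set
    adj?       : Decidable Adj
    adj-sym    : Symmetric Adj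
    adj-irrefl : Irreflexive _≡_ Adj

complete : ∀ n → Graph n
complete n = record
  { Adj        = _≢_
  ; adj?       = λ u v → ¬? (u ≟ v)
  ; adj-sym    = λ u≢v → u≢v ∘ sym
  ; adj-irrefl = λ u≡v u≢v → u≢v u≡v
  }

-- The element i of Fin p stands for the time-step suc (toℕ i) in {1, …, p}.
-- Because Adj is symmetric, label-sym also makes the label independent of
-- the proof of adjacency: it is a function on undirected edges.
record PeriodicLabeling (p : ℕ) {n : ℕ} (G : Graph n) : Set where
  open Graph G
  field
    label     : ∀ {u v} → Adj u v → Fin p
    label-sym : ∀ {u v} (e : Adj u v) (e′ : Adj v u) → label e ≡ label e′

  Present : ∀ {u v} → Adj u v → ℕ → Set
  Present e t = ∃[ k ] t ≡ suc (toℕ (label e)) + k * p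

module Temporal {p n : ℕ} (G : Graph n) (ℓ : PeriodicLabeling p G) where
  open Graph G
  open PeriodicLabeling ℓ

  -- TimedWalk u v t: a walk from u to v with strictly increasing time-steps,
  -- the last being t. The trivial walk arrives at 0; as all labels are
  -- positive, this puts no constraint on the first time-step.
  data TimedWalk (u : Fin n) : Fin n → ℕ → Set where
    stay : TimedWalk u u 0
    step : ∀ {v w t t′} → TimedWalk u v t →
           (e : Adj v w) → Present e t′ → t < t′ → TimedWalk u w t′

  vertices : ∀ {u v t} → TimedWalk u v t → List (Fin n)
  vertices {u} stay                 = u ∷ []
  vertices {v = w} (step walk _ _ _) = w ∷ vertices walk

  Journey : Fin n → Fin n → ℕ → Set
  Journey u v t = Σ[ walk ∈ TimedWalk u v t ] Unique (vertices walk)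

  -- IsDist u v d says dist_t(u,v) = d, where ⊤⁺ is ∞.
  IsDist : Fin n → Fin n → ℕ ⁺ → Set
  IsDist u v [ t ] = Journey u v t × (∀ t′ → Journey u v t′ → t ≤ t′)
  IsDist u v ⊤⁺    = ∀ t → ¬ Journey u v t

  Resolves : Fin n → Fin n → Fin n → Set
  Resolves s u v = ∃[ d ] ∃[ d′ ] IsDist s u d × IsDist s v d′ × d ≢ d′

  record IsResolvingSet (R : Subset n) : Set where
    field
      reaches   : ∀ v → ∃[ s ] s ∈ R × ∃[ t ] Journey s v t
      separates : ∀ u v → u ≢ v → ∃[ s ] s ∈ R × Resolves s u v

-- IsM G ℓ m says M_p(G, ℓ) = m.
IsM : ∀ {p n} (G : Graph n) → PeriodicLabeling p G → ℕ → Set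
IsM {n = n} G ℓ m =
  (∃[ R ] IsResolvingSet R × ∣ R ∣ ≡ m) ×
  (∀ (R : Subset n) → IsResolvingSet R → m ≤ ∣ R ∣)
  where open Temporal G ℓ

{-# OPTIONS --safe #-}

-- The distance from a vertex of K_n to any other lies in {1, …, p}, so the
-- n − k vertices outside a resolving set of size k have distinct distance
-- vectors in {1, …, p}^k, whence n ≤ k + p^k and b ≤ k. All vertices but one
-- always form a resolving set, and none smaller exists if all labels are equal.
--
-- For the tightness of b, the vertices are b landmarks s_i and the vectors
-- x ∈ {1, …, p}^b. The edge s_i x gets label 1 if x_i = 1 and p otherwise,
-- landmarks are joined with label p, and the edge x y gets the largest entry of
-- x and y at the coordinates where they differ. No information travels faster
-- than intended: a walk from s_i reaches x no sooner than x_i, since an edge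
-- x y with x_i ≠ y_i has label at least y_i. Conversely s_i reaches x at time
-- x_i through the vector obtained from x by replacing x_i with 1.

module Submission where

open import Defs
open import Data.Nat using (ℕ; _+_; _∸_; _^_; _≤_)
open import Data.Product using (∃-syntax; Σ-syntax; _×_)

import Algebra.Construct.NaturalChoice.Max as Max
open import Data.Fin as Fin using (Fin; zero; suc; toℕ; fromℕ; fromℕ<; splitAt; _↑ˡ_; _↑ʳ_; finToFun; funToFin)
import Data.Fin.Properties as Fin
open import Data.Fin.Subset using (Subset; inside; outside; ⊤; ⊥; ∁; ⁅_⁆; ∣_∣; Nonempty; _∈_; _∉_)
open import Data.Fin.Subset.Properties using (_∈?_; nonempty?; anySubset?; ∣⊥∣≡0; ∣∁p∣≡n∸∣p∣; ∣⁅x⁆∣≡1; x∉p⇒x∈∁p; x∈⁅y⁆⇒x≡y)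
open import Data.List using ([]; _∷_)
import Data.List as List
import Data.List.Extrema as Extrema
import Data.List.Membership.DecPropositional as ListMembership
open import Data.List.Properties using (tabulate-cong)
open import Data.List.Relation.Unary.All using ([]; _∷_)
open import Data.List.Relation.Unary.All.Properties using (¬Any⇒All¬; tabulate⁺; tabulate⁻)
open import Data.List.Relation.Unary.AllPairs using ([]; _∷_)
open import Data.List.Relation.Unary.Any using (here; there)
open import Data.List.Relation.Unary.Unique.Propositional using (Unique)
open import Data.Nat using (zero; suc; _*_; _<_; _≟_; z≤n; z<s; s≤s; s≤s⁻¹; NonZero)
open import Data.Nat.Induction using (Acc; acc; <-wellFounded)
open import Data.Nat.Properties using
  ( ≤-refl; ≤-reflexive; ≤-trans; ≤-antisym; <-≤-trans; ≤-<-trans; <⇒≤; n≮n; ≮⇒≥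
  ; m≤m+n; m≤n+m; m≤m*n; +-comm; +-identityʳ; +-mono-<-≤; ^-monoʳ-≤; m^n>0; m≤n+o⇒m∸n≤o; suc-injective; anyUpTo?)
open import Data.Product using (_,_; proj₁; proj₂)
open import Data.Sum using (_⊎_; inj₁; inj₂)
import Data.Sum as Sum
open import Data.Sum.Properties using (inj₁-injective; inj₂-injective)
open import Data.Vec using (_∷_; _++_; here; there)
open import Data.Vec.Functional using (updateAt)
open import Data.Vec.Functional.Properties using (updateAt-updates; updateAt-minimal)
open import Function using (_∘_; const)
open import Relation.Binary.PropositionalEquality using (_≡_; _≢_; refl; sym; trans; cong; cong₂; subst)
open import Relation.Nullary using (¬_; Dec; yes; no; contradiction)
open import Relation.Nullary.Construct.Add.Supremum using (⊤⁺; [_]; []-injective)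
open import Relation.Nullary.Decidable using (map′; ¬?; _×-dec_; _→-dec_; decidable-stable)
open import Relation.Unary using (Decidable)

-- Least witnesses, encodings of finite functions, and counting outside a subset.

least : ∀ {P : ℕ → Set} → Decidable P → ∀ {t} → P t → ∃[ m ] P m × (∀ k → P k → m ≤ k)
least {P} P? = go (<-wellFounded _)
  where
  go : ∀ {t} → Acc _<_ t → P t → ∃[ m ] P m × (∀ k → P k → m ≤ k)
  go {t} (acc rs) Pt with anyUpTo? P? t
  ... | yes (k , k<t , Pk) = go (rs k<t) Pk
  ... | no ∄k<t            = t , Pt , λ k Pk → ≮⇒≥ λ k<t → ∄k<t (k , k<t , Pk)

finToFun-injective : ∀ {m n} {x y : Fin (m ^ n)} → (∀ i → finToFun {m} {n} x i ≡ finToFun y i) → x ≡ y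
finToFun-injective {m} {n} {x} {y} x≗y =
  trans (sym (Fin.funToFin-finToFin {n} {m} x))
    (trans (funToFin-cong x≗y) (Fin.funToFin-finToFin {n} {m} y))
  where
  funToFin-cong : ∀ {k} {f g : Fin k → Fin m} → (∀ i → f i ≡ g i) → funToFin f ≡ funToFin g
  funToFin-cong {zero}  f≗g = refl
  funToFin-cong {suc k} f≗g = cong₂ Fin.combine (f≗g zero) (funToFin-cong (f≗g ∘ suc))

-- Equality of functions is only obtained pointwise, which avoids extensionality.
funToFin-injective : ∀ {m n} {f g : Fin m → Fin n} → funToFin f ≡ funToFin g → ∀ i → f i ≡ g i
funToFin-injective {f = f} {g} eq i =
  trans (sym (Fin.finToFun-funToFin f i))
    (trans (cong (λ x → finToFun x i) eq) (Fin.finToFun-funToFin g i))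

nth : ∀ {n} (R : Subset n) → Fin ∣ R ∣ → Fin n
nth (inside  ∷ R) zero    = zero
nth (inside  ∷ R) (suc i) = suc (nth R i)
nth (outside ∷ R) i       = suc (nth R i)

nth-∈ : ∀ {n} (R : Subset n) i → nth R i ∈ R
nth-∈ (inside  ∷ R) zero    = here
nth-∈ (inside  ∷ R) (suc i) = there (nth-∈ R i)
nth-∈ (outside ∷ R) i       = there (nth-∈ R i)

nth-surjective : ∀ {n} (R : Subset n) {x} → x ∈ R → ∃[ i ] nth R i ≡ x
nth-surjective (inside  ∷ R) here        = zero , refl
nth-surjective (inside  ∷ R) (there x∈R) = let i , eq = nth-surjective R x∈R in suc i , cong suc eq
nth-surjective (outside ∷ R) (there x∈R) = let i , eq = nth-surjective R x∈R in i , cong suc eq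

-- Members of `R` are sent to their positions in `R`, all other elements to their codes; this is an
-- injection into a disjoint union of size `∣ R ∣ + m`.
∁-injective⇒≤ : ∀ {n m} (R : Subset n) (f : ∀ v → v ∉ R → Fin m) →
                (∀ {u v} (u∉R : u ∉ R) (v∉R : v ∉ R) → f u u∉R ≡ f v v∉R → u ≡ v) →
                n ≤ ∣ R ∣ + m
∁-injective⇒≤ {n} {m} R f f-injective = Fin.injective⇒≤ λ {u} {v} eq →
  g-injective u v (trans (sym (Fin.splitAt-join ∣ R ∣ m (g u)))
    (trans (cong (splitAt ∣ R ∣) eq) (Fin.splitAt-join ∣ R ∣ m (g v))))
  where
  g : Fin n → Fin ∣ R ∣ ⊎ Fin m
  g v with v ∈? R
  ... | yes v∈R = inj₁ (proj₁ (nth-surjective R v∈R))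
  ... | no  v∉R = inj₂ (f v v∉R)

  g-injective : ∀ u v → g u ≡ g v → u ≡ v
  g-injective u v eq with u ∈? R | v ∈? R
  ... | yes u∈R | yes v∈R = trans (sym (proj₂ (nth-surjective R u∈R)))
          (trans (cong (nth R) (inj₁-injective eq)) (proj₂ (nth-surjective R v∈R)))
  ... | no  u∉R | no  v∉R = f-injective u∉R v∉R (inj₂-injective eq)
  g-injective u v () | yes _ | no _
  g-injective u v () | no _  | yes _

-- Walks versus journeys, and decidability of temporal reachability.

module Walks {p n} {G : Graph n} (ℓ : PeriodicLabeling p G) where
  open Graph G
  open PeriodicLabeling ℓ
  open Temporal G ℓ
  open ListMembership (Fin._≟_ {n}) using () renaming (_∈_ to _∈ˡ_; _∈?_ to _∈ˡ?_)

  -- Both labels equal that of one and the same reversed edge.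
  label-irrelevant : ∀ {u v} (e e′ : Adj u v) → label e ≡ label e′
  label-irrelevant e e′ = trans (label-sym e (adj-sym e)) (sym (label-sym e′ (adj-sym e)))

  present? : ∀ {u v} (e : Adj u v) t → Dec (Present e t)
  present? e t = map′
    (λ (k , _ , eq) → k , eq)
    -- Since `p` is positive, `k ≤ k * p ≤ t`, so only finitely many periods need checking.
    (λ (k , eq) → k , s≤s (≤-trans (≤-trans (m≤m*n k p) (m≤n+m (k * p) _)) (≤-reflexive (sym eq))) , eq)
    (anyUpTo? (λ k → t ≟ suc (toℕ (label e)) + k * p) (suc t))
    where instance
      p≢0 : NonZero p
      p≢0 = Fin.nonZeroIndex (label e)

  -- Recursion on the arrival time: before its last edge a walk arrives strictly earlier, which
  -- leaves finitely many penultimate vertices and times.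
  walk? : ∀ u v t → Dec (TimedWalk u v t)
  walk? u v t = go v (<-wellFounded t)
    where
    Last : Fin n → ℕ → Fin n → Set
    Last w t v = (Σ[ e ∈ Adj v w ] Present e t) × (∃[ t′ ] t′ < t × TimedWalk u v t′)

    present-edge? : ∀ v w t → Dec (Σ[ e ∈ Adj v w ] Present e t)
    present-edge? v w t with adj? v w
    ... | no ¬e = no (¬e ∘ proj₁)
    ... | yes e = map′ (e ,_)
      (λ (e′ , k , eq) → k , trans eq (cong (λ l → suc (toℕ l) + k * p) (label-irrelevant e′ e)))
      (present? e t)

    go : ∀ w {t} → Acc _<_ t → Dec (TimedWalk u w t)
    go w {zero} _ = map′ (λ { refl → stay }) (λ { stay → refl ; (step _ _ _ ()) }) (u Fin.≟ w)
    go w {suc t} (acc rs) = map′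
      (λ (v , (e , pr) , t′ , t′<t , walk) → step walk e pr t′<t)
      (λ { (step walk e pr t′<t) → _ , (e , pr) , _ , t′<t , walk })
      (Fin.any? λ v → present-edge? v w (suc t) ×-dec earlier? v)
      where
      earlier? : ∀ v → Dec (∃[ t′ ] t′ < suc t × TimedWalk u v t′)
      earlier? v with Fin.any? (λ (i : Fin (suc t)) → go v (rs (Fin.toℕ<n i)))
      ... | yes (i , walk) = yes (toℕ i , Fin.toℕ<n i , walk)
      ... | no ∄ = no λ (t′ , t′<t , walk) →
              ∄ (fromℕ< t′<t , subst (TimedWalk u v) (sym (Fin.toℕ-fromℕ< t′<t)) walk)

  -- The initial segment ending at `x` inherits distinctness of its vertices.
  truncate : ∀ {u v x t} (walk : TimedWalk u v t) → Unique (vertices walk) → x ∈ˡ vertices walk →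
             ∃[ t′ ] t′ ≤ t × Journey u x t′
  truncate stay                   uniq       (here refl) = 0 , z≤n , stay , uniq
  truncate walk@(step _ _ _ _)    uniq       (here refl) = _ , ≤-refl , walk , uniq
  truncate (step walk _ _ t<t′)   (_ ∷ uniq) (there x∈)  =
    let t₀ , t₀≤t , j = truncate walk uniq x∈ in t₀ , ≤-trans t₀≤t (<⇒≤ t<t′) , j

  -- When the last step returns to a visited vertex, the walk is cut back to that visit; this can
  -- only make the arrival earlier. Hence earliest arrivals may be computed with walks, which need
  -- no distinctness condition.
  walk⇒journey : ∀ {u v t} → TimedWalk u v t → ∃[ t′ ] t′ ≤ t × Journey u v t′
  walk⇒journey stay = 0 , z≤n , stay , [] ∷ []
  walk⇒journey (step {w = w} walk e pr t<t′) with walk⇒journey walk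
  ... | t₀ , t₀≤t , walk₀ , uniq with w ∈ˡ? vertices walk₀
  ...   | yes w∈ = let t₁ , t₁≤t₀ , j = truncate walk₀ uniq w∈
                   in t₁ , ≤-trans t₁≤t₀ (≤-trans t₀≤t (<⇒≤ t<t′)) , j
  ...   | no  w∉ = _ , ≤-refl , step walk₀ e pr (≤-<-trans t₀≤t t<t′) , ¬Any⇒All¬ _ w∉ ∷ uniq

  minimal-walk⇒isDist : ∀ {u v t} → TimedWalk u v t → (∀ t′ → TimedWalk u v t′ → t ≤ t′) → IsDist u v [ t ]
  minimal-walk⇒isDist walk minimal with walk⇒journey walk
  ... | t′ , t′≤t , j = subst (Journey _ _) (≤-antisym t′≤t (minimal t′ (proj₁ j))) j ,
                        λ t″ j″ → minimal t″ (proj₁ j″)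

  walk⇒isDist : ∀ {u v t} → TimedWalk u v t → ∃[ d ] d ≤ t × IsDist u v [ d ]
  walk⇒isDist {u} {v} {t} walk =
    let d , walk′ , minimal = least (walk? u v) walk
    in d , minimal t walk , minimal-walk⇒isDist walk′ minimal

  isDist-unique : ∀ {u v d d′} → IsDist u v d → IsDist u v d′ → d ≡ d′
  isDist-unique {d = [ _ ]} {[ _ ]} (j , m) (j′ , m′) = cong [_] (≤-antisym (m _ j′) (m′ _ j))
  isDist-unique {d = [ _ ]} {⊤⁺}    (j , _) ∄j        = contradiction j (∄j _)
  isDist-unique {d = ⊤⁺}    {[ _ ]} ∄j      (j , _)   = contradiction j (∄j _)
  isDist-unique {d = ⊤⁺}    {⊤⁺}    _       _         = refl

  isDist-refl : ∀ u → IsDist u u [ 0 ]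
  isDist-refl u = (stay , [] ∷ []) , λ _ _ → z≤n

  walk-positive : ∀ {u v t} → u ≢ v → TimedWalk u v t → 1 ≤ t
  walk-positive u≢v stay                  = contradiction refl u≢v
  walk-positive u≢v (step _ _ _ t<t′)     = ≤-trans (s≤s z≤n) t<t′

-- Distances and resolving sets in complete graphs.

module Complete {p n} (ℓ : PeriodicLabeling p (complete n)) where
  open PeriodicLabeling ℓ
  open Temporal (complete n) ℓ
  open Walks ℓ public

  edge-walk : ∀ {u v} (u≢v : u ≢ v) → TimedWalk u v (suc (toℕ (label u≢v)))
  edge-walk u≢v = step stay u≢v (0 , sym (+-identityʳ _)) z<s

  -- The direct edge bounds the distance by `p`. Storing its predecessor in `Fin p` makes it a digit
  -- of a code.
  dist : ∀ u v → u ≢ v → ∃[ i ] IsDist u v [ suc (toℕ {p} i) ]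
  dist u v u≢v with walk⇒isDist (edge-walk u≢v)
  ... | zero  , _    , (walk , _) , _ = contradiction (walk-positive u≢v walk) λ ()
  ... | suc d , d<l  , isDist         =
    fromℕ< d<p , subst (λ t → IsDist u v [ suc t ]) (sym (Fin.toℕ-fromℕ< d<p)) isDist
    where d<p = <-≤-trans (s≤s (s≤s⁻¹ d<l)) (Fin.toℕ<n (label u≢v))

  finite-dist : ∀ u v → ∃[ d ] IsDist u v [ d ]
  finite-dist u v with u Fin.≟ v
  ... | yes refl = 0 , isDist-refl u
  ... | no  u≢v  = let i , isDist = dist u v u≢v in suc (toℕ i) , isDist

  resolves? : ∀ s u v → Dec (Resolves s u v)
  resolves? s u v =
    let d  , isDist  = finite-dist s u
        d′ , isDist′ = finite-dist s v
    in map′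
      (λ d≢d′ → [ d ] , [ d′ ] , isDist , isDist′ , d≢d′ ∘ []-injective)
      (λ (_ , _ , isDist₁ , isDist₁′ , d₁≢d₁′) d≡d′ → d₁≢d₁′
        (trans (isDist-unique isDist₁ isDist) (trans (cong [_] d≡d′) (isDist-unique isDist′ isDist₁′))))
      (¬? (d ≟ d′))

  resolves-selfˡ : ∀ {u v} → u ≢ v → Resolves u u v
  resolves-selfˡ {u} {v} u≢v = let i , isDist = dist u v u≢v in
    [ 0 ] , [ suc (toℕ i) ] , isDist-refl u , isDist , λ ()

  resolves-sym : ∀ {s u v} → Resolves s u v → Resolves s v u
  resolves-sym (d , d′ , isDist , isDist′ , d≢d′) = d′ , d , isDist′ , isDist , d≢d′ ∘ sym

  -- All distances are finite, so the reachability condition reduces to nonemptiness.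
  resolvingSet⁺ : ∀ {R} → Nonempty R → (∀ u v → u ≢ v → ∃[ s ] s ∈ R × Resolves s u v) → IsResolvingSet R
  resolvingSet⁺ (s , s∈R) separates = record
    { reaches   = λ v → let d , j , _ = finite-dist s v in s , s∈R , d , j
    ; separates = separates
    }

  resolvingSet? : Fin n → Decidable IsResolvingSet
  resolvingSet? x R = map′
    (λ (ne , sep) → resolvingSet⁺ ne sep)
    (λ rs → let s , s∈R , _ = IsResolvingSet.reaches rs x in (s , s∈R) , IsResolvingSet.separates rs)
    (nonempty? R ×-dec
     Fin.all? λ u → Fin.all? λ v → ¬? (u Fin.≟ v) →-dec Fin.any? λ s → (s ∈? R) ×-dec resolves? s u v)

  minimum-exists : Fin n → ∀ {R} → IsResolvingSet R → ∃[ m ] IsM (complete n) ℓ m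
  minimum-exists x rs =
    let m , attained , minimal = least (λ m → anySubset? λ R → resolvingSet? x R ×-dec (∣ R ∣ ≟ m)) (_ , rs , refl)
    in m , attained , λ R rs′ → minimal ∣ R ∣ (R , rs′ , refl)

  order≤ : ∀ {R} → IsResolvingSet R → n ≤ ∣ R ∣ + p ^ ∣ R ∣
  order≤ {R} rs = ∁-injective⇒≤ R code code-injective
    where
    nth≢ : ∀ {v} → v ∉ R → ∀ i → nth R i ≢ v
    nth≢ v∉R i eq = v∉R (subst (_∈ R) eq (nth-∈ R i))

    code : ∀ v → v ∉ R → Fin (p ^ ∣ R ∣)
    code v v∉R = funToFin λ i → proj₁ (dist (nth R i) v (nth≢ v∉R i))

    code-injective : ∀ {u v} (u∉R : u ∉ R) (v∉R : v ∉ R) → code u u∉R ≡ code v v∉R → u ≡ v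
    code-injective {u} {v} u∉R v∉R eq = decidable-stable (u Fin.≟ v) λ u≢v →
      let s , s∈R , d , d′ , isDist , isDist′ , d≢d′ = IsResolvingSet.separates rs u v u≢v
          i , s≡nth = nth-surjective R s∈R
          -- Distances from the separating vertex `s` are the digits at its position `i`, so equal
          -- codes contradict separation.
          via : ∀ {w d} (w∉R : w ∉ R) → IsDist s w d →
                d ≡ [ suc (toℕ (proj₁ (dist (nth R i) w (nth≢ w∉R i)))) ]
          via w∉R isDistw = isDist-unique (subst (λ s → IsDist s _ _) (sym s≡nth) isDistw)
                                          (proj₂ (dist (nth R i) _ (nth≢ w∉R i)))
      in d≢d′ (trans (via u∉R isDist)
           (trans (cong (λ j → [ suc (toℕ j) ]) (funToFin-injective eq i)) (sym (via v∉R isDist′))))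

  -- Of two distinct vertices one differs from `x`, and it separates the pair, being at distance 0
  -- only from itself. The vertex `y` provides nonemptiness.
  ∁⁅x⁆-resolving : ∀ {x y} → y ≢ x → IsResolvingSet (∁ ⁅ x ⁆)
  ∁⁅x⁆-resolving {x} {y} y≢x = resolvingSet⁺ (y , member y≢x) separates
    where
    member : ∀ {z} → z ≢ x → z ∈ ∁ ⁅ x ⁆
    member z≢x = x∉p⇒x∈∁p (z≢x ∘ x∈⁅y⁆⇒x≡y x)

    separates : ∀ u v → u ≢ v → ∃[ s ] s ∈ ∁ ⁅ x ⁆ × Resolves s u v
    separates u v u≢v with u Fin.≟ x
    ... | no  u≢x  = u , member u≢x , resolves-selfˡ u≢v
    ... | yes refl = v , member (u≢v ∘ sym) , resolves-sym (resolves-selfˡ (u≢v ∘ sym))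

-- Sizes of resolving sets: the lower bound, and the labeling with all labels equal.

∣∁⁅x⁆∣ : ∀ {n} (x : Fin n) → ∣ ∁ ⁅ x ⁆ ∣ ≡ n ∸ 1
∣∁⁅x⁆∣ {n} x = trans (∣∁p∣≡n∸∣p∣ ⁅ x ⁆) (cong (n ∸_) (∣⁅x⁆∣≡1 x))

-- The function `k + p ^ k` of `k` is strictly increasing, so `∣ R ∣ < b` would contradict `order≤`.
resolvingSet-size≥ : ∀ {p b} .{{_ : NonZero p}} (ℓ : PeriodicLabeling p (complete (b + p ^ b))) →
                     ∀ R → Temporal.IsResolvingSet (complete (b + p ^ b)) ℓ R → b ≤ ∣ R ∣
resolvingSet-size≥ {p} ℓ R rs = ≮⇒≥ λ ∣R∣<b →
  n≮n _ (<-≤-trans (+-mono-<-≤ ∣R∣<b (^-monoʳ-≤ p (<⇒≤ ∣R∣<b))) (Complete.order≤ ℓ rs))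

constantLabeling : ∀ {q n} → PeriodicLabeling (suc q) (complete n)
constantLabeling = record { label = λ _ → zero ; label-sym = λ _ _ → refl }

-- Distinct vertices are all at distance 1, so two vertices outside `R` could not be separated: the
-- constant code in `Fin 1` is injective there.
constantLabeling-size≥ : ∀ {q n} R →
  Temporal.IsResolvingSet (complete n) (constantLabeling {q}) R → n ∸ 1 ≤ ∣ R ∣
constantLabeling-size≥ {q} {n} R rs =
  m≤n+o⇒m∸n≤o n 1 (subst (n ≤_) (+-comm ∣ R ∣ 1) (∁-injective⇒≤ R (λ _ _ → zero) same))
  where
  open Complete (constantLabeling {q} {n})
  open Temporal (complete n) (constantLabeling {q} {n})

  unit-dist : ∀ {u v} → u ≢ v → IsDist u v [ 1 ]
  unit-dist u≢v = minimal-walk⇒isDist (edge-walk u≢v) λ _ → walk-positive u≢v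

  same : ∀ {u v} → u ∉ R → v ∉ R → zero {0} ≡ zero → u ≡ v
  same {u} {v} u∉R v∉R _ = decidable-stable (u Fin.≟ v) λ u≢v →
    let s , s∈R , d , d′ , isDist , isDist′ , d≢d′ = IsResolvingSet.separates rs u v u≢v
        s≢ : ∀ {w} → w ∉ R → s ≢ w
        s≢ w∉R eq = w∉R (subst (_∈ R) eq s∈R)
    in d≢d′ (trans (isDist-unique isDist (unit-dist (s≢ u∉R)))
                   (isDist-unique (unit-dist (s≢ v∉R)) isDist′))

-- The labeling that attains the lower bound.

module Landmarks (q b : ℕ) where
  p = suc q
  n = b + p ^ b

  Vertex : Set
  Vertex = Fin b ⊎ (Fin b → Fin p)

  vertex : Fin n → Vertex
  vertex x = Sum.map₂ finToFun (splitAt b x)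

  landmark : Fin b → Fin n
  landmark i = i ↑ˡ (p ^ b)

  vector : (Fin b → Fin p) → Fin n
  vector x = b ↑ʳ funToFin x

  vertex-landmark : ∀ i → vertex (landmark i) ≡ inj₁ i
  vertex-landmark i = cong (Sum.map₂ finToFun) (Fin.splitAt-↑ˡ b i (p ^ b))

  -- The decoded function agrees with `x` only pointwise, so the round trip stays in the statement.
  vertex-vector : ∀ x → vertex (vector x) ≡ inj₂ (finToFun (funToFin x))
  vertex-vector x = cong (Sum.map₂ finToFun) (Fin.splitAt-↑ʳ b (p ^ b) (funToFin x))

  open Max (Fin.≤-totalOrder p) using (_⊔_; ⊔-comm; ⊔-lub; x≤y⊔x)
  open Extrema (Fin.≤-totalOrder p) using (max; xs≤max; max≤v⁺)

  -- Agreeing coordinates yield `zero`, which is neutral for the maximum. Elements of `Fin p` are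
  -- one less than the time-steps they denote.
  entry : Fin p → Fin p → Fin p
  entry a c with a Fin.≟ c
  ... | yes _ = zero
  ... | no  _ = a ⊔ c

  entry-comm : ∀ a c → entry a c ≡ entry c a
  entry-comm a c with a Fin.≟ c | c Fin.≟ a
  ... | yes _   | yes _   = refl
  ... | no  _   | no  _   = ⊔-comm a c
  ... | yes a≡c | no  c≢a = contradiction (sym a≡c) c≢a
  ... | no  a≢c | yes c≡a = contradiction (sym c≡a) a≢c

  entry≥ʳ : ∀ {a c} → a ≢ c → c Fin.≤ entry a c
  entry≥ʳ {a} {c} a≢c with a Fin.≟ c
  ... | yes a≡c = contradiction a≡c a≢c
  ... | no  _   = x≤y⊔x a c

  vectorLabel : (x y : Fin b → Fin p) → Fin p
  vectorLabel x y = max zero (List.tabulate λ j → entry (x j) (y j))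

  -- This blocks shortcuts: an edge that changes coordinate `j` is not present before the time given
  -- by the new value.
  vectorLabel≥ : ∀ x y {j} → x j ≢ y j → y j Fin.≤ vectorLabel x y
  vectorLabel≥ x y {j} x≢y = ≤-trans (entry≥ʳ x≢y) (tabulate⁻ (xs≤max zero (List.tabulate λ j → entry (x j) (y j))) j)

  -- Only coordinate `i` contributes to the maximum, and there the entry is the larger of `zero` and
  -- `y i`.
  vectorLabel-reset : ∀ x y {i} → x i ≡ zero → (∀ j → j ≢ i → x j ≡ y j) → y i ≢ zero → vectorLabel x y ≡ y i
  vectorLabel-reset x y {i} xᵢ≡0 x≗y yᵢ≢0 = Fin.≤-antisym
    (max≤v⁺ z≤n (tabulate⁺ entry≤))
    (vectorLabel≥ x y λ xᵢ≡yᵢ → yᵢ≢0 (trans (sym xᵢ≡yᵢ) xᵢ≡0))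
    where
    entry≤ : ∀ j → entry (x j) (y j) Fin.≤ y i
    entry≤ j with x j Fin.≟ y j
    ... | yes _   = z≤n
    ... | no  x≢y with j Fin.≟ i
    ...   | yes refl = ⊔-lub (subst (Fin._≤ y i) (sym xᵢ≡0) z≤n) ≤-refl
    ...   | no  j≢i  = contradiction (x≗y j j≢i) x≢y

  landmarkLabel : Fin p → Fin p
  landmarkLabel zero    = zero
  landmarkLabel (suc _) = fromℕ q

  edgeLabel : Vertex → Vertex → Fin p
  edgeLabel (inj₁ _) (inj₁ _) = fromℕ q
  edgeLabel (inj₁ i) (inj₂ x) = landmarkLabel (x i)
  edgeLabel (inj₂ x) (inj₁ i) = landmarkLabel (x i)
  edgeLabel (inj₂ x) (inj₂ y) = vectorLabel x y

  edgeLabel-sym : ∀ x y → edgeLabel x y ≡ edgeLabel y x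
  edgeLabel-sym (inj₁ _) (inj₁ _) = refl
  edgeLabel-sym (inj₁ _) (inj₂ _) = refl
  edgeLabel-sym (inj₂ _) (inj₁ _) = refl
  edgeLabel-sym (inj₂ x) (inj₂ y) = cong (max zero) (tabulate-cong λ j → entry-comm (x j) (y j))

  labeling : PeriodicLabeling p (complete n)
  labeling = record
    { label     = λ {u} {v} _ → edgeLabel (vertex u) (vertex v)
    ; label-sym = λ {u} {v} _ _ → edgeLabel-sym (vertex u) (vertex v)
    }

  open Complete labeling
  open Temporal (complete n) labeling

  -- Landmarks other than s_i are useless as intermediate vertices because they
  -- are not reached from s_i before time p.
  arrival : Fin b → Vertex → ℕ
  arrival i (inj₂ x) = suc (toℕ (x i))
  arrival i (inj₁ j) with i Fin.≟ j
  ... | yes _ = 0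
  ... | no  _ = p

  last-label⇒≥p : ∀ {t k} → t ≡ suc (toℕ (fromℕ q)) + k * p → p ≤ t
  last-label⇒≥p refl rewrite Fin.toℕ-fromℕ q = m≤m+n p _

  -- `arrival i` acts as a potential: no edge, at any of its time-steps, lets a walk get below it.
  arrival-step : ∀ i x y {t t′} k → arrival i x ≤ t → t < t′ →
                 t′ ≡ suc (toℕ (edgeLabel x y)) + k * p → arrival i y ≤ t′
  arrival-step i x (inj₁ j) k x≤t t<t′ eq with i Fin.≟ j
  arrival-step i x (inj₁ j) k x≤t t<t′ eq | yes _ = z≤n
  arrival-step i (inj₁ _) (inj₁ j) k x≤t t<t′ eq | no _ = last-label⇒≥p {k = k} eq
  arrival-step i (inj₂ x) (inj₁ j) k x≤t t<t′ eq | no _ with x j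
  ... | suc _ = last-label⇒≥p {k = k} eq
  -- The edge has label 1, but the walk is at `x` at time 1 or later, so time-step 1 is missed and
  -- the next one is at least `1 + p`.
  arrival-step i (inj₂ x) (inj₁ j) zero    x≤t t<t′ refl | no _ | zero =
    contradiction (≤-<-trans (≤-trans (s≤s z≤n) x≤t) t<t′) (n≮n 1)
  arrival-step i (inj₂ x) (inj₁ j) (suc k) x≤t t<t′ refl | no _ | zero =
    ≤-trans (m≤m+n p (k * p)) (m≤n+m _ 1)
  arrival-step i (inj₁ j) (inj₂ y) k x≤t t<t′ eq with i Fin.≟ j
  -- At a landmark other than the source the time is already at least `p`, which no coordinate
  -- exceeds.
  ... | no  _    = ≤-trans (Fin.toℕ<n (y i)) (≤-trans x≤t (<⇒≤ t<t′))
  ... | yes refl with y i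
  ...   | zero  = ≤-trans (s≤s z≤n) t<t′
  ...   | suc a = ≤-trans (Fin.toℕ<n (suc a)) (last-label⇒≥p {k = k} eq)
  arrival-step i (inj₂ x) (inj₂ y) k x≤t t<t′ eq with x i Fin.≟ y i
  ... | yes xᵢ≡yᵢ = subst (λ a → suc (toℕ a) ≤ _) xᵢ≡yᵢ (≤-trans x≤t (<⇒≤ t<t′))
  ... | no  xᵢ≢yᵢ = ≤-trans (s≤s (vectorLabel≥ x y xᵢ≢yᵢ)) (≤-trans (m≤m+n _ (k * p)) (≤-reflexive (sym eq)))

  arrival≤ : ∀ i {v t} → TimedWalk (landmark i) v t → arrival i (vertex v) ≤ t
  arrival≤ i stay rewrite vertex-landmark i with i Fin.≟ i
  ... | yes _   = z≤n
  ... | no  i≢i = contradiction refl i≢i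
  arrival≤ i (step {v} {w} walk _ (k , eq) t<t′) =
    arrival-step i (vertex v) (vertex w) k (arrival≤ i walk) t<t′ eq

  landmark≢ : ∀ i {v x} → vertex v ≡ inj₂ x → landmark i ≢ v
  landmark≢ i eq refl with () ← trans (sym (vertex-landmark i)) eq

  arrival-walk : ∀ i {v x} → vertex v ≡ inj₂ x → TimedWalk (landmark i) v (suc (toℕ (x i)))
  arrival-walk i {v} {x} eq with x i in xᵢ≡
  ... | zero  = subst (TimedWalk (landmark i) v) (cong (suc ∘ toℕ) label≡0) (edge-walk (landmark≢ i eq))
    where
    label≡0 : edgeLabel (vertex (landmark i)) (vertex v) ≡ zero
    label≡0 = trans (cong₂ edgeLabel (vertex-landmark i) eq) (cong landmarkLabel xᵢ≡)
  -- The detour: `w` is `v` with coordinate `i` reset, so it is reached at time 1, and the edge to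
  -- `v` then appears at time `suc (suc a)`.
  ... | suc a = step walk w≢v (0 , cong suc (trans (cong toℕ (sym label≡)) (sym (+-identityʳ _)))) (s≤s z<s)
    where
    y = finToFun (funToFin (updateAt x i (const zero)))
    w = vector (updateAt x i (const zero))

    yᵢ≡0 : y i ≡ zero
    yᵢ≡0 = trans (Fin.finToFun-funToFin (updateAt x i (const zero)) i) (updateAt-updates i x)

    y≗x : ∀ j → j ≢ i → y j ≡ x j
    y≗x j j≢i = trans (Fin.finToFun-funToFin (updateAt x i (const zero)) j) (updateAt-minimal j i x j≢i)

    w-vertex : vertex w ≡ inj₂ y
    w-vertex = vertex-vector (updateAt x i (const zero))

    w≢v : w ≢ v
    w≢v w≡v with () ← trans (sym yᵢ≡0)
      (trans (cong (λ z → z i) (inj₂-injective (trans (sym w-vertex) (trans (cong vertex w≡v) eq)))) xᵢ≡)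

    label≡ : edgeLabel (vertex w) (vertex v) ≡ suc a
    label≡ = trans (cong₂ edgeLabel w-vertex eq)
      (trans (vectorLabel-reset y x yᵢ≡0 y≗x λ xᵢ≡0 → Fin.0≢1+n (trans (sym xᵢ≡0) xᵢ≡)) xᵢ≡)

    walk : TimedWalk (landmark i) w 1
    walk = subst (TimedWalk (landmark i) w)
      (cong (suc ∘ toℕ) (trans (cong₂ edgeLabel (vertex-landmark i) w-vertex) (cong landmarkLabel yᵢ≡0)))
      (edge-walk (landmark≢ i w-vertex))

  -- The walk of `arrival-walk` meets the bound `arrival≤`; thus the distances from the landmarks to
  -- a vector spell out its coordinates.
  landmark-dist : ∀ i {v x} → vertex v ≡ inj₂ x → IsDist (landmark i) v [ suc (toℕ (x i)) ]
  landmark-dist i eq = minimal-walk⇒isDist (arrival-walk i eq)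
    λ t walk → subst (λ z → arrival i z ≤ t) eq (arrival≤ i walk)

  landmarks : Subset n
  landmarks = ⊤ {b} ++ ⊥

-- The landmarks as a resolving set.

∣⊤++⊥∣ : ∀ m k → ∣ ⊤ {m} ++ ⊥ {k} ∣ ≡ m
∣⊤++⊥∣ zero    k = ∣⊥∣≡0 k
∣⊤++⊥∣ (suc m) k = cong suc (∣⊤++⊥∣ m k)

↑ˡ-∈-⊤++⊥ : ∀ {m} k (i : Fin m) → i ↑ˡ k ∈ ⊤ {m} ++ ⊥ {k}
↑ˡ-∈-⊤++⊥ k zero    = here
↑ˡ-∈-⊤++⊥ k (suc i) = there (↑ˡ-∈-⊤++⊥ k i)

landmarks-resolving : ∀ q {b} → 1 ≤ b → let open Landmarks q b in
                      Temporal.IsResolvingSet (complete n) labeling landmarks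
landmarks-resolving q {b@(suc _)} _ = resolvingSet⁺ (landmark zero , ∈landmarks zero) separates
  where
  open Landmarks q b
  open Complete labeling
  open Temporal (complete n) labeling

  ∈landmarks : ∀ i → landmark i ∈ landmarks
  ∈landmarks = ↑ˡ-∈-⊤++⊥ (p ^ b)

  separates : ∀ u v → u ≢ v → ∃[ s ] s ∈ landmarks × Resolves s u v
  separates u v u≢v with splitAt b u in equ | splitAt b v in eqv
  ... | inj₁ i | _      = u , subst (_∈ landmarks) (Fin.splitAt⁻¹-↑ˡ equ) (∈landmarks i) , resolves-selfˡ u≢v
  ... | inj₂ _ | inj₁ i = v , subst (_∈ landmarks) (Fin.splitAt⁻¹-↑ˡ eqv) (∈landmarks i) ,
                          resolves-sym (resolves-selfˡ (u≢v ∘ sym))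
  ... | inj₂ x | inj₂ y =
    -- Distinct vectors differ at some coordinate, found by finite search, and the landmark of that
    -- coordinate separates them.
    let i , xᵢ≢yᵢ = Fin.¬∀⟶∃¬ b _ (λ i → finToFun {p} x i Fin.≟ finToFun y i) λ x≗y →
          u≢v (trans (sym (Fin.splitAt⁻¹-↑ʳ equ))
            (trans (cong (b ↑ʳ_) (finToFun-injective {p} {b} x≗y)) (Fin.splitAt⁻¹-↑ʳ eqv)))
    in landmark i , ∈landmarks i , _ , _ ,
       landmark-dist i (cong (Sum.map₂ finToFun) equ) , landmark-dist i (cong (Sum.map₂ finToFun) eqv) ,
       λ eq → xᵢ≢yᵢ (Fin.toℕ-injective (suc-injective ([]-injective eq)))

-- Both bounds and their tightness.

two-vertices : ∀ {m k} → 1 ≤ m → 1 ≤ k → Σ[ x ∈ Fin (m + k) ] ∃[ y ] y ≢ x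
two-vertices {suc m} {k} _ 1≤k = zero , suc (m ↑ʳ fromℕ< 1≤k) , λ ()

theorem13 : (p b : ℕ) → 1 ≤ p → 1 ≤ b →
    let n = b + p ^ b
        K = complete n
    in ((ℓ : PeriodicLabeling p K) → ∃[ m ] IsM K ℓ m × b ≤ m × m ≤ n ∸ 1)
       × (Σ[ ℓ ∈ PeriodicLabeling p K ] IsM K ℓ b)
       × (Σ[ ℓ ∈ PeriodicLabeling p K ] IsM K ℓ (n ∸ 1))
theorem13 p@(suc q) b 1≤p 1≤b = bounds , lower-tight , upper-tight
  where
  n = b + p ^ b
  K = complete n

  -- Both `b` and `p ^ b` are at least 1, so deleting `x` leaves a nonempty set.
  vertices = two-vertices 1≤b (m^n>0 p b)
  x   = proj₁ vertices
  y≢x = proj₂ (proj₂ vertices)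

  bounds : (ℓ : PeriodicLabeling p K) → ∃[ m ] IsM K ℓ m × b ≤ m × m ≤ n ∸ 1
  bounds ℓ with Complete.minimum-exists ℓ x (Complete.∁⁅x⁆-resolving ℓ y≢x)
  ... | m , isM@((R , rs , refl) , minimal) =
    m , isM , resolvingSet-size≥ ℓ R rs ,
    subst (m ≤_) (∣∁⁅x⁆∣ x) (minimal (∁ ⁅ x ⁆) (Complete.∁⁅x⁆-resolving ℓ y≢x))

  lower-tight : Σ[ ℓ ∈ PeriodicLabeling p K ] IsM K ℓ b
  lower-tight = labeling ,
    (landmarks , landmarks-resolving q 1≤b , ∣⊤++⊥∣ b (p ^ b)) , resolvingSet-size≥ labeling
    where open Landmarks q b using (labeling; landmarks)

  upper-tight : Σ[ ℓ ∈ PeriodicLabeling p K ] IsM K ℓ (n ∸ 1)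
  upper-tight = constantLabeling ,
    (∁ ⁅ x ⁆ , Complete.∁⁅x⁆-resolving constantLabeling y≢x , ∣∁⁅x⁆∣ x) , constantLabeling-size≥
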